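{- Let $N \geq 2$ and $M \geq 1$ be integers, and let $F(X_1,\dots,X_N) \in \mathbb{Z}[X_1,\dots,X_N]$ be a non-zero homogeneous polynomial in $N$ variables of degree $M$. Then there exists a point $\boldsymbol{x} \in \mathbb{Z}^N$ such that $F(\boldsymbol{x}) \neq 0$ and $$\mathcal{L}(\boldsymbol{x}) \leq \left[ \frac{M+2}{2}\ \min \left\{ N, \frac{M+2}{4} \right\} \right].$$
   Context: For $\boldsymbol{x}=(x_1,\dots,x_N)\in\mathbb{Z}^N$, the length is $\mathcal{L}(\boldsymbol{x})=\sum_{i=1}^N|x_i|$. For a real number $t$, $[t]$ denotes its integer part. -}

module Defs where

open import Data.Bool.Base using (if_then_else_)
open import Data.Integer.Base as ℤ using (ℤ; +_; 0ℤ; 1ℤ; ∣_∣)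
open import Data.List.Base using (List; []; _∷_)
open import Data.Nat.Base as ℕ using (ℕ)
import Data.Nat.Properties as ℕₚ
open import Data.Product.Base using (_×_; _,_)
open import Data.Rational.Base as ℚ using (ℚ; _/_; floor)
open import Data.Vec.Base as Vec using (Vec)
open import Data.Vec.Properties using (≡-dec)
open import Relation.Binary.PropositionalEquality.Core using (_≡_; _≢_)
open import Relation.Nullary.Decidable.Core using (does)

-- (d₁ , … , d_N) stands for the monomial X₁^d₁ ⋯ X_N^d_N.
Exponent : ℕ → Set
Exponent N = Vec ℕ N

-- ℤ[X₁, …, X_N]: finite formal sums of terms c · X^d.  Exponents may repeat and
-- coefficients may vanish, so equality of polynomials is _≈_ below, not _≡_.
Polynomial : ℕ → Set
Polynomial N = List (ℤ × Exponent N)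

coeff : ∀ {N} → Polynomial N → Exponent N → ℤ
coeff []            e = 0ℤ
coeff ((c , d) ∷ F) e =
  if does (≡-dec ℕₚ._≟_ d e) then c ℤ.+ coeff F e else coeff F e

infix 4 _≈_
_≈_ : ∀ {N} → Polynomial N → Polynomial N → Set
F ≈ G = ∀ e → coeff F e ≡ coeff G e

0ₚ : ∀ {N} → Polynomial N
0ₚ = []

-- The zero polynomial is homogeneous of every degree.
Homogeneous : ∀ {N} → ℕ → Polynomial N → Set
Homogeneous M F = ∀ e → coeff F e ≢ 0ℤ → Vec.sum e ≡ M

evalMonomial : ∀ {N} → Exponent N → Vec ℤ N → ℤ
evalMonomial d x = Vec.foldr′ ℤ._*_ 1ℤ (Vec.zipWith ℤ._^_ x d)

eval : ∀ {N} → Polynomial N → Vec ℤ N → ℤ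
eval []            x = 0ℤ
eval ((c , d) ∷ F) x = c ℤ.* evalMonomial d x ℤ.+ eval F x

ℒ : ∀ {N} → Vec ℤ N → ℕ
ℒ x = Vec.sum (Vec.map ∣_∣ x)

-- All quantities are rational, so ℚ's floor is the integer part [ t ].
lengthBound : ℕ → ℕ → ℤ
lengthBound N M =
  floor ((+ (M ℕ.+ 2) / 2) ℚ.* ((+ N / 1) ℚ.⊓ (+ (M ℕ.+ 2) / 4)))

{-# OPTIONS --safe #-}
-- Since M ≤ (M+2)/2 · N and 8M ≤ (M+2)², it is enough to find a point of length at
-- most M where F does not vanish.  More generally, a non-zero polynomial of degree at
-- most M does not vanish on all of {y ∈ ℕ^N : y₁ + ⋯ + y_N ≤ M}.  Write
-- F = ∑ X₁^j G_j and let k be the largest index with G_k ≠ 0.  By induction there is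
-- y with G_k(y) ≠ 0 and ∑ y ≤ M - k, and F(X₁, y) has degree exactly k, so it
-- does not vanish at some x ∈ {0, …, k}.
module Submission where

open import Defs
open import Data.Nat.Base using (ℕ; _≥_)
open import Data.Integer.Base using (ℤ; +_; 0ℤ; _≤_)
open import Data.Product.Base using (Σ-syntax; _×_)
open import Data.Vec.Base using (Vec)
open import Relation.Binary.PropositionalEquality.Core using (_≢_)
open import Relation.Nullary.Negation.Core using (¬_)

open import Data.Empty using (⊥-elim)
open import Data.Integer.Base as ℤ using (1ℤ)
open import Data.Integer.DivMod using (n<s[n/ℕd]*d; div-pos-is-/ℕ)
import Data.Integer.Properties as ℤₚ
open import Data.Integer.Tactic.RingSolver using (solve-∀)
open import Data.List.Base using ([]; _∷_)
open import Data.List.Relation.Unary.All as All using (All; []; _∷_)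
open import Data.Nat.Base as ℕ using (zero; suc; s≤s; z≤n)
import Data.Nat.Properties as ℕₚ
import Data.Nat.Tactic.RingSolver as ℕSolver
open import Data.Product.Base using (_,_; ∃-syntax; proj₁; proj₂)
open import Data.Rational.Base as ℚ using (ℚ; mkℚ; floor; toℚᵘ)
import Data.Rational.Properties as ℚₚ
open import Data.Rational.Unnormalised.Base as ℚᵘ using (mkℚᵘ)
import Data.Rational.Unnormalised.Properties as ℚᵘₚ
open import Data.Sum.Base using (_⊎_; inj₁; inj₂; [_,_]′)
open import Data.Vec.Base as Vec using ([]; _∷_)
open import Function.Base using (_∘_)
open import Relation.Binary.PropositionalEquality
  using (_≡_; refl; sym; trans; cong; cong₂; subst; module ≡-Reasoning)
open import Relation.Nullary.Decidable.Core using (yes; no)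

-- Integer polynomials in one variable and their non-roots.

-- With the leading coefficient `l` kept apart from the lower ones, the degree is exactly `n` as
-- soon as `l ≢ 0ℤ`.
horner : ∀ {n} → ℤ → Vec ℤ n → ℤ → ℤ
horner l cs x = Vec.foldr′ (λ c r → c ℤ.+ x ℤ.* r) l cs

-- Synthetic division: dividing `horner l (c ∷ cs)` by X - a gives the coefficients
-- `quotient l cs a` below the unchanged leading `l`; `c` enters only the remainder.
quotient : ∀ {n} → ℤ → Vec ℤ n → ℤ → Vec ℤ n
quotient l []       a = []
quotient l (c ∷ cs) a = horner l (c ∷ cs) a ∷ quotient l cs a

horner-division : ∀ {n} l c (cs : Vec ℤ n) a x →
  horner l (c ∷ cs) x ≡
  horner l (c ∷ cs) a ℤ.+ (x ℤ.- a) ℤ.* horner l (quotient l cs a) x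
horner-division l c []        a x = identity c l a x
  where
  identity : ∀ c l a x →
    c ℤ.+ x ℤ.* l ≡ c ℤ.+ a ℤ.* l ℤ.+ (x ℤ.- a) ℤ.* l
  identity = solve-∀
horner-division l c (d ∷ ds) a x = begin
  c ℤ.+ x ℤ.* horner l (d ∷ ds) x
    ≡⟨ cong (λ r → c ℤ.+ x ℤ.* r) (horner-division l d ds a x) ⟩
  c ℤ.+ x ℤ.* (horner l (d ∷ ds) a ℤ.+ (x ℤ.- a) ℤ.* horner l (quotient l ds a) x)
    ≡⟨ identity c (horner l (d ∷ ds) a) (horner l (quotient l ds a) x) a x ⟩
  horner l (c ∷ d ∷ ds) a ℤ.+ (x ℤ.- a) ℤ.* horner l (quotient l (d ∷ ds) a) x ∎
  where
  open ≡-Reasoning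
  identity : ∀ c h q a x →
    c ℤ.+ x ℤ.* (h ℤ.+ (x ℤ.- a) ℤ.* q) ≡
    c ℤ.+ a ℤ.* h ℤ.+ (x ℤ.- a) ℤ.* (h ℤ.+ x ℤ.* q)
  identity = solve-∀

-- If `a` is a root, divide by X - a: the quotient has degree one less and the same `l`. A non-root
-- of it that is at least `suc a` differs from `a`, so neither factor vanishes there. The start `a`
-- varies for the sake of this recursion.
horner-nonroot : ∀ {n} l → l ≢ 0ℤ → (cs : Vec ℤ n) → ∀ a →
  ∃[ x ] a ℕ.≤ x × x ℕ.≤ a ℕ.+ n × horner l cs (+ x) ≢ 0ℤ
horner-nonroot l l≢0 [] a = a , ℕₚ.≤-refl , ℕₚ.m≤m+n a 0 , l≢0
horner-nonroot {suc n} l l≢0 (c ∷ cs) a with horner l (c ∷ cs) (+ a) ℤₚ.≟ 0ℤ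
... | no p[a]≢0 = a , ℕₚ.≤-refl , ℕₚ.m≤m+n a (suc n) , p[a]≢0
... | yes p[a]≡0
  with horner-nonroot l l≢0 (quotient l cs (+ a)) (suc a)
... | x , a<x , x≤ , q[x]≢0 =
  x , ℕₚ.<⇒≤ a<x , ℕₚ.≤-trans x≤ (ℕₚ.≤-reflexive (sym (ℕₚ.+-suc a n))) , p[x]≢0
  where
  p[x] : horner l (c ∷ cs) (+ x) ≡
         (+ x ℤ.- + a) ℤ.* horner l (quotient l cs (+ a)) (+ x)
  p[x] = trans (horner-division l c cs (+ a) (+ x))
               (trans (cong (ℤ._+ _) p[a]≡0) (ℤₚ.+-identityˡ _))

  p[x]≢0 : horner l (c ∷ cs) (+ x) ≢ 0ℤ
  p[x]≢0 p[x]≡0 =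
    [ (λ x-a≡0 → ℕₚ.<⇒≢ a<x (sym (ℤₚ.+-injective (ℤₚ.i-j≡0⇒i≡j (+ x) (+ a) x-a≡0))))
    , q[x]≢0
    ]′ (ℤₚ.i*j≡0⇒i≡0∨j≡0 (+ x ℤ.- + a) (trans (sym p[x]) p[x]≡0))

-- Polynomials in X₁ over the other variables.

constantTerm : ∀ {N} → Polynomial (suc N) → Polynomial N
constantTerm []                    = []
constantTerm ((c , zero  ∷ d) ∷ F) = (c , d) ∷ constantTerm F
constantTerm ((c , suc _ ∷ d) ∷ F) = constantTerm F

divX₁ : ∀ {N} → Polynomial (suc N) → Polynomial (suc N)
divX₁ []                    = []
divX₁ ((c , zero  ∷ d) ∷ F) = divX₁ F
divX₁ ((c , suc k ∷ d) ∷ F) = (c , k ∷ d) ∷ divX₁ F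

coeff-constantTerm : ∀ {N} (F : Polynomial (suc N)) e →
  coeff (constantTerm F) e ≡ coeff F (0 ∷ e)
coeff-constantTerm []                    e = refl
coeff-constantTerm ((c , zero  ∷ d) ∷ F) e rewrite coeff-constantTerm F e = refl
coeff-constantTerm ((c , suc k ∷ d) ∷ F) e = coeff-constantTerm F e

coeff-divX₁ : ∀ {N} (F : Polynomial (suc N)) k e →
  coeff (divX₁ F) (k ∷ e) ≡ coeff F (suc k ∷ e)
coeff-divX₁ []                    k e = refl
coeff-divX₁ ((c , zero  ∷ d) ∷ F) k e = coeff-divX₁ F k e
coeff-divX₁ ((c , suc j ∷ d) ∷ F) k e rewrite coeff-divX₁ F k e = refl

eval-split : ∀ {N} (F : Polynomial (suc N)) x y →
  eval F (x ∷ y) ≡ eval (constantTerm F) y ℤ.+ x ℤ.* eval (divX₁ F) (x ∷ y)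
eval-split []                    x y = sym (trans (ℤₚ.+-identityˡ _) (ℤₚ.*-zeroʳ x))
eval-split ((c , zero  ∷ d) ∷ F) x y = trans
  (cong (λ t → c ℤ.* (1ℤ ℤ.* evalMonomial d y) ℤ.+ t) (eval-split F x y))
  (identity c (evalMonomial d y) (eval (constantTerm F) y) (x ℤ.* eval (divX₁ F) (x ∷ y)))
  where
  identity : ∀ c m s t →
    c ℤ.* (1ℤ ℤ.* m) ℤ.+ (s ℤ.+ t) ≡ c ℤ.* m ℤ.+ s ℤ.+ t
  identity = solve-∀
eval-split ((c , suc k ∷ d) ∷ F) x y = trans
  (cong (λ t → c ℤ.* (x ℤ.* x ℤ.^ k ℤ.* evalMonomial d y) ℤ.+ t) (eval-split F x y))
  (identity c x (x ℤ.^ k) (evalMonomial d y) (eval (constantTerm F) y) (eval (divX₁ F) (x ∷ y)))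
  where
  identity : ∀ c x p m s t →
    c ℤ.* (x ℤ.* p ℤ.* m) ℤ.+ (s ℤ.+ x ℤ.* t) ≡
    s ℤ.+ x ℤ.* (c ℤ.* (p ℤ.* m) ℤ.+ t)
  identity = solve-∀

constantTerm-≈0 : ∀ {N} {F : Polynomial (suc N)} → F ≈ 0ₚ → constantTerm F ≈ 0ₚ
constantTerm-≈0 {F = F} F≈0 e = trans (coeff-constantTerm F e) (F≈0 (0 ∷ e))

divX₁-≈0 : ∀ {N} {F : Polynomial (suc N)} → F ≈ 0ₚ → divX₁ F ≈ 0ₚ
divX₁-≈0 {F = F} F≈0 (k ∷ e) = trans (coeff-divX₁ F k e) (F≈0 (suc k ∷ e))

≈0-split : ∀ {N} {F : Polynomial (suc N)} → constantTerm F ≈ 0ₚ → divX₁ F ≈ 0ₚ → F ≈ 0ₚ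
≈0-split {F = F} F₀≈0 F′≈0 (zero  ∷ e) = trans (sym (coeff-constantTerm F e)) (F₀≈0 e)
≈0-split {F = F} F₀≈0 F′≈0 (suc k ∷ e) = trans (sym (coeff-divX₁ F k e)) (F′≈0 (k ∷ e))

-- This bounds every listed term, even those that cancel, so it can measure a recursion on a
-- polynomial that is only `≈ 0ₚ`.
X₁-DegreesBelow : ∀ {N} → ℕ → Polynomial (suc N) → Set
X₁-DegreesBelow K = All (λ t → Vec.head (proj₂ t) ℕ.< K)

X₁-degreesBounded : ∀ {N} (F : Polynomial (suc N)) → ∃[ K ] X₁-DegreesBelow K F
X₁-degreesBounded []            = 0 , []
X₁-degreesBounded ((c , d) ∷ F) with X₁-degreesBounded F
... | K , F<K = suc (Vec.head d) ℕ.⊔ K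
              , ℕₚ.m≤m⊔n _ K
              ∷ All.map (λ <K → ℕₚ.≤-trans <K (ℕₚ.m≤n⊔m (suc (Vec.head d)) K)) F<K

divX₁-degreesBelow : ∀ {N K} (F : Polynomial (suc N)) →
  X₁-DegreesBelow (suc K) F → X₁-DegreesBelow K (divX₁ F)
divX₁-degreesBelow []                    []             = []
divX₁-degreesBelow ((c , zero  ∷ d) ∷ F) (_ ∷ F<)       = divX₁-degreesBelow F F<
divX₁-degreesBelow ((c , suc k ∷ d) ∷ F) (s≤s k< ∷ F<)  = k< ∷ divX₁-degreesBelow F F<

eval-constant : (F : Polynomial 0) → eval F [] ≡ coeff F []
eval-constant []             = refl
eval-constant ((c , []) ∷ F) = cong₂ ℤ._+_ (ℤₚ.*-identityʳ c) (eval-constant F)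

-- Induction on the number of variables, and inside it on the bound `K`: both pieces of a split are
-- again `≈ 0ₚ`, and for `K = 0` the list is empty.
eval-≈0 : ∀ {N} (F : Polynomial N) → F ≈ 0ₚ → ∀ x → eval F x ≡ 0ℤ
eval-≈0 {zero}  F F≈0 []      = trans (eval-constant F) (F≈0 [])
eval-≈0 {suc N} F F≈0 (x ∷ y) = go (proj₁ bound) F (proj₂ bound) F≈0
  where
  bound : ∃[ K ] X₁-DegreesBelow K F
  bound = X₁-degreesBounded F

  go : ∀ K (G : Polynomial (suc N)) → X₁-DegreesBelow K G → G ≈ 0ₚ → eval G (x ∷ y) ≡ 0ℤ
  go zero    []      _       _   = refl
  go zero    (_ ∷ _) (() ∷ _) _
  go (suc K) G       G<      G≈0 = begin
    eval G (x ∷ y)                                               ≡⟨ eval-split G x y ⟩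
    eval (constantTerm G) y ℤ.+ x ℤ.* eval (divX₁ G) (x ∷ y)
      ≡⟨ cong₂ (λ s t → s ℤ.+ x ℤ.* t)
               (eval-≈0 (constantTerm G) (constantTerm-≈0 {F = G} G≈0) y)
               (go K (divX₁ G) (divX₁-degreesBelow G G<) (divX₁-≈0 {F = G} G≈0)) ⟩
    0ℤ ℤ.+ x ℤ.* 0ℤ                                              ≡⟨ ℤₚ.+-identityˡ _ ⟩
    x ℤ.* 0ℤ                                                     ≡⟨ ℤₚ.*-zeroʳ x ⟩
    0ℤ                                                           ∎
    where open ≡-Reasoning

-- Small non-roots in several variables.

-- The bound is strict so that `D = 0` forces the zero polynomial, the base case of the induction on
-- `D`.
DegreeBelow : ∀ {N} → ℕ → Polynomial N → Set
DegreeBelow D F = ∀ e → coeff F e ≢ 0ℤ → Vec.sum e ℕ.< D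

constantTerm-degree : ∀ {N D} (F : Polynomial (suc N)) →
  DegreeBelow D F → DegreeBelow D (constantTerm F)
constantTerm-degree F F< e c≢0 = F< (0 ∷ e) (c≢0 ∘ trans (coeff-constantTerm F e))

divX₁-degree : ∀ {N D} (F : Polynomial (suc N)) →
  DegreeBelow (suc D) F → DegreeBelow D (divX₁ F)
divX₁-degree F F< (k ∷ e) c≢0 =
  ℕₚ.≤-pred (F< (suc k ∷ e) (c≢0 ∘ trans (coeff-divX₁ F k e)))

degreeBelow-0 : ∀ {N} (F : Polynomial N) → DegreeBelow 0 F → F ≈ 0ₚ
degreeBelow-0 F F< e with coeff F e ℤₚ.≟ 0ℤ
... | yes c≡0 = c≡0
... | no  c≢0 with () ← F< e c≢0

NonrootBelow : ∀ {N} → ℕ → Polynomial N → Set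
NonrootBelow {N} D F =
  Σ[ y ∈ Vec ℕ N ] (Vec.sum y ℕ.< D × eval F (Vec.map +_ y) ≢ 0ℤ)

-- A line X₁ ↦ (X₁, y) on which F has degree exactly k, with leading coefficient l.
record NonzeroLine {N} (D : ℕ) (F : Polynomial (suc N)) : Set where
  field
    {k}     : ℕ
    y       : Vec ℕ N
    l       : ℤ
    cs      : Vec ℤ k
    l≢0     : l ≢ 0ℤ
    small   : k ℕ.+ Vec.sum y ℕ.< D
    on-line : ∀ x → eval F (x ∷ Vec.map +_ y) ≡ horner l cs x

line-nonroot : ∀ {N D} {F : Polynomial (suc N)} → NonzeroLine D F → NonrootBelow D F
line-nonroot {F = F} line
  with horner-nonroot l l≢0 cs 0
  where open NonzeroLine line
... | x , _ , x≤k , p[x]≢0 =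
  x ∷ y , ℕₚ.≤-<-trans (ℕₚ.+-monoˡ-≤ (Vec.sum y) x≤k) small
        , p[x]≢0 ∘ trans (sym (on-line (+ x)))
  where open NonzeroLine line

-- The disjunction lets the recursion decide which coefficients G_j vanish. Dividing by X₁ lowers
-- `D`; passing to a constant term lowers the number of variables.
zero-or-nonroot : ∀ {N} D (F : Polynomial N) → DegreeBelow D F →
  F ≈ 0ₚ ⊎ NonrootBelow D F
-- X₁ is divided out down to `D = 0`; on the way back, the first non-zero constant term met is G_k
-- with k largest.
zero-or-line : ∀ {N} D (F : Polynomial (suc N)) → DegreeBelow D F →
  F ≈ 0ₚ ⊎ NonzeroLine D F

zero-or-nonroot {zero} D F F< with coeff F [] ℤₚ.≟ 0ℤ
... | yes c≡0 = inj₁ λ { [] → c≡0 }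
... | no  c≢0 = inj₂ ([] , F< [] c≢0 , c≢0 ∘ trans (sym (eval-constant F)))
zero-or-nonroot {suc N} D F F< with zero-or-line D F F<
... | inj₁ F≈0  = inj₁ F≈0
... | inj₂ line = inj₂ (line-nonroot line)

zero-or-line zero    F F< = inj₁ (degreeBelow-0 F F<)
zero-or-line (suc D) F F<
  with zero-or-line D (divX₁ F) (divX₁-degree F F<)
-- Multiplying by X₁ and adding the constant term prepends one coefficient; the degree on the line
-- and the bound both grow by one.
... | inj₂ line = inj₂ record
  { y       = y
  ; l       = l
  ; cs      = eval (constantTerm F) (Vec.map +_ y) ∷ cs
  ; l≢0     = l≢0
  ; small   = s≤s small
  ; on-line = λ x → trans (eval-split F x _)
      (cong (λ r → eval (constantTerm F) (Vec.map +_ y) ℤ.+ x ℤ.* r) (on-line x))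
  }
  where open NonzeroLine line
... | inj₁ F′≈0
  with zero-or-nonroot (suc D) (constantTerm F) (constantTerm-degree F F<)
... | inj₁ F₀≈0 = inj₁ (≈0-split {F = F} F₀≈0 F′≈0)
-- Here k = 0: the X₁ part evaluates to zero, so F is constant on the line.
... | inj₂ (y , Σy<D , F₀[y]≢0) = inj₂ record
  { y       = y
  ; l       = eval (constantTerm F) (Vec.map +_ y)
  ; cs      = []
  ; l≢0     = F₀[y]≢0
  ; small   = Σy<D
  ; on-line = λ x → trans (eval-split F x _)
      (trans (cong (λ r → eval (constantTerm F) (Vec.map +_ y) ℤ.+ x ℤ.* r)
                   (eval-≈0 (divX₁ F) F′≈0 _))
             (trans (cong (λ t → eval (constantTerm F) (Vec.map +_ y) ℤ.+ t) (ℤₚ.*-zeroʳ x))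
                    (ℤₚ.+-identityʳ _)))
  }

-- Comparison of M with the length bound.

ℒ-map-+ : ∀ {N} (y : Vec ℕ N) → ℒ (Vec.map +_ y) ≡ Vec.sum y
ℒ-map-+ []      = refl
ℒ-map-+ (n ∷ y) = cong (n ℕ.+_) (ℒ-map-+ y)

-- For q = n/d, z d ≤ n < (1 + floor q) d; cancel d.
≤-floor : ∀ z q → z ℚ./ 1 ℚ.≤ q → z ≤ floor q
≤-floor z q@(mkℚ n d-1 _) z/1≤q = subst (z ≤_)
  (trans (ℤₚ.pred-suc (n ℤ./ℕ suc d-1)) (sym (div-pos-is-/ℕ n (suc d-1))))
  (ℤₚ.i<j⇒i≤pred[j] (ℤₚ.*-cancelʳ-<-nonNeg {z} {ℤ.suc (n ℤ./ℕ suc d-1)} (+ suc d-1)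
    (ℤₚ.≤-<-trans z*d≤n (n<s[n/ℕd]*d n (suc d-1)))))
  where
  z*d≤n : z ℤ.* + suc d-1 ≤ n
  z*d≤n with ℚᵘₚ.≤-respˡ-≃ (ℚₚ.toℚᵘ-fromℚᵘ (mkℚᵘ z 0)) (ℚₚ.toℚᵘ-mono-≤ z/1≤q)
  ... | ℚᵘ.*≤* z*d≤n*1 = subst (z ℤ.* + suc d-1 ≤_) (ℤₚ.*-identityʳ n) z*d≤n*1

-- In unnormalised rationals the claim is plain cross-multiplication, with no reduction to lowest
-- terms.
≤-product : ∀ m a b c d → m ℕ.* (suc b ℕ.* suc d) ℕ.≤ a ℕ.* c →
  + m ℚ./ 1 ℚ.≤ (+ a ℚ./ suc b) ℚ.* (+ c ℚ./ suc d)
≤-product m a b c d mbd≤ac = ℚₚ.toℚᵘ-cancel-≤ (begin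
  toℚᵘ (+ m ℚ./ 1)                                 ≃⟨ ℚₚ.toℚᵘ-fromℚᵘ (mkℚᵘ (+ m) 0) ⟩
  mkℚᵘ (+ m) 0                                     ≤⟨ ℚᵘ.*≤* cross ⟩
  mkℚᵘ (+ a) b ℚᵘ.* mkℚᵘ (+ c) d
    ≃⟨ ℚᵘₚ.*-cong (ℚₚ.toℚᵘ-fromℚᵘ (mkℚᵘ (+ a) b)) (ℚₚ.toℚᵘ-fromℚᵘ (mkℚᵘ (+ c) d)) ⟨
  toℚᵘ (+ a ℚ./ suc b) ℚᵘ.* toℚᵘ (+ c ℚ./ suc d)   ≃⟨ ℚₚ.toℚᵘ-homo-* (+ a ℚ./ suc b) (+ c ℚ./ suc d) ⟨
  toℚᵘ ((+ a ℚ./ suc b) ℚ.* (+ c ℚ./ suc d))       ∎)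
  where
  open ℚᵘₚ.≤-Reasoning
  cross : + m ℤ.* + (suc b ℕ.* suc d) ≤ + a ℤ.* + c ℤ.* 1ℤ
  cross rewrite ℤₚ.*-identityʳ (+ a ℤ.* + c)
              | sym (ℤₚ.pos-* a c) | sym (ℤₚ.pos-* m (suc b ℕ.* suc d)) = ℤ.+≤+ mbd≤ac

2M≤[M+2]N : ∀ M N → N ≥ 2 → M ℕ.* 2 ℕ.≤ (M ℕ.+ 2) ℕ.* N
2M≤[M+2]N M N N≥2 = ℕₚ.*-mono-≤ (ℕₚ.m≤m+n M 2) N≥2

-- The difference of the two sides is (M - 2)², which is `k * k` for M = k + 2.
8M≤[M+2]² : ∀ M → M ℕ.* 8 ℕ.≤ (M ℕ.+ 2) ℕ.* (M ℕ.+ 2)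
8M≤[M+2]² 0             = z≤n
8M≤[M+2]² 1             = ℕₚ.n≤1+n 8
8M≤[M+2]² (suc (suc k)) =
  subst (suc (suc k) ℕ.* 8 ℕ.≤_) (identity k) (ℕₚ.m≤m+n _ (k ℕ.* k))
  where
  identity : ∀ k → (2 ℕ.+ k) ℕ.* 8 ℕ.+ k ℕ.* k ≡ (2 ℕ.+ k ℕ.+ 2) ℕ.* (2 ℕ.+ k ℕ.+ 2)
  identity = ℕSolver.solve-∀

M≤lengthBound : ∀ N M → N ≥ 2 → + M ≤ lengthBound N M
M≤lengthBound N M N≥2 = ≤-floor (+ M) _ (subst (+ M ℚ./ 1 ℚ.≤_)
  (sym (ℚₚ.*-distribˡ-⊓-nonNeg half {{ℚₚ.normalize-nonNeg (M ℕ.+ 2) 2}} (+ N ℚ./ 1) (+ (M ℕ.+ 2) ℚ./ 4)))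
  -- After distributing over the minimum, each argument is bounded separately; 1, 0 and 3 are the
  -- denominators 2, 1 and 4 less one.
  (ℚₚ.⊓-glb (≤-product M (M ℕ.+ 2) 1 N 0 (2M≤[M+2]N M N N≥2))
            (≤-product M (M ℕ.+ 2) 1 (M ℕ.+ 2) 3 (8M≤[M+2]² M))))
  where
  half : ℚ
  half = + (M ℕ.+ 2) ℚ./ 2

proposition2p4 : (N M : ℕ) → N ≥ 2 → M ≥ 1 →
    (F : Polynomial N) → ¬ (F ≈ 0ₚ) → Homogeneous M F →
    Σ[ x ∈ Vec ℤ N ] (eval F x ≢ 0ℤ × + ℒ x ≤ lengthBound N M)
proposition2p4 N M N≥2 _ F F≉0 F-hom
  with zero-or-nonroot (suc M) F (λ e c≢0 → s≤s (ℕₚ.≤-reflexive (F-hom e c≢0)))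
... | inj₁ F≈0 = ⊥-elim (F≉0 F≈0)
... | inj₂ (y , s≤s Σy≤M , F[y]≢0) =
  Vec.map +_ y , F[y]≢0 ,
  ℤₚ.≤-trans (ℤ.+≤+ (ℕₚ.≤-trans (ℕₚ.≤-reflexive (ℒ-map-+ y)) Σy≤M)) (M≤lengthBound N M N≥2)
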